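{- Let $W$ be a finite Weyl group with set of simple reflections $S=\{s_1,\dots,s_n\}$, and let $W_J$ be the standard parabolic subgroup generated by a subset $J\subseteq S$. Let $W^J$ denote the set of minimal length representatives of the left cosets in $W/W_J$. Then the language $\mathcal L(W^J)$, consisting of all reduced words over the alphabet $S$ representing the elements of $W^J$, is a regular language.
   Context: $W^J=\{w\in W:\ell(ws_j)>\ell(w)\text{ for all }s_j\in J\}$, where $\ell$ is the length function with respect to $S$. Convention on words: the word $s_{i_1}s_{i_2}\cdots s_{i_t}$ over the alphabet $S$, read from left to right, represents the group element $s_{i_t}\cdots s_{i_2}s_{i_1}$ (each newly read letter multiplies on the left); it is reduced if $t$ equals the length of this element. For example, in type $A_2$ with $J=\{s_1\}$ one has $W^J=\{e,s_2,s_1s_2\}$ and $\mathcal L(W^J)=\{\varepsilon,\,s_2,\,s_2s_1\}$. A language is regular if it is recognized by a deterministic finite automaton. -}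

module Defs where

open import Level using (_⊔_)
open import Algebra.Bundles using (CommutativeRing; Group; Ring)
open import Algebra.Apartness.Bundles using (HeytingField; HeytingCommutativeRing)
open import Algebra.Module.Bundles using (LeftModule)
open import Algebra.Module.Morphism.Structures using (module LeftModuleMorphisms)
import Algebra.Definitions.RawMonoid as RawMonoidDefs
import Algebra.Module.Construct.TensorUnit as TensorUnit
import Algebra.Properties.AbelianGroup as AbelianGroupProps
import Algebra.Properties.Ring as RingProps
open import Data.Fin.Base using (Fin)
open import Data.Fin.Subset using (Subset; _∈_)
open import Data.List.Base using (List; []; _∷_; _++_; _∷ʳ_; [_]; foldl; length; reverse)
open import Data.List.Properties using (reverse-involutive; unfold-reverse)
open import Data.Nat.Base using (ℕ; suc; _≤_; _<_)
open import Data.Product.Base using (∃; ∃₂; _×_; _,_)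
open import Data.Sum.Base using (_⊎_)
open import Function.Base using (_∘_; id)
open import Function.Bundles using (_⇔_)
open import Function.Definitions using (Injective)
open import Relation.Binary.PropositionalEquality.Core as ≡ using (_≡_)
open import Relation.Unary using (Pred)
import Relation.Binary.Reasoning.Setoid as SetoidReasoning

record DFA (σ : ℕ) : Set where
  field
    states    : ℕ
    start     : Fin states
    step      : Fin states → Fin σ → Fin states
    accepting : Subset states

  Accepts : List (Fin σ) → Set
  Accepts w = foldl step start w ∈ accepting

Regular : ∀ {σ ℓ} → Pred (List (Fin σ)) ℓ → Set ℓ
Regular {σ} L = ∃ λ (D : DFA σ) → ∀ w → L w ⇔ DFA.Accepts D w

module Words {c ℓ} (W : Group c ℓ) {n : ℕ} (s : Fin n → Group.Carrier W) where
  open Group W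

  -- Each newly read letter multiplies on the left, so the word
  -- i₁ ∷ i₂ ∷ … ∷ iₜ ∷ [] represents s iₜ ∙ … ∙ s i₂ ∙ s i₁.
  value : List (Fin n) → Carrier
  value []      = ε
  value (i ∷ u) = value u ∙ s i

  -- The length function is presented by its graph: HasLength w k says
  -- ℓ(w) = k.
  HasLength : Carrier → ℕ → Set ℓ
  HasLength w k =
      (∃ λ u → value u ≈ w × length u ≡ k)
    × (∀ u → value u ≈ w → k ≤ length u)

  Reduced : List (Fin n) → Set ℓ
  Reduced u = HasLength (value u) (length u)

  -- The set W^J = { w : ℓ(w s_j) > ℓ(w) for every j ∈ J } of minimal
  -- length representatives of the left cosets of W_J.
  MinimalRep : Subset n → Pred Carrier ℓ
  MinimalRep J w = ∀ j → j ∈ J →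
    ∃₂ λ k l → HasLength w k × HasLength (w ∙ s j) l × k < l

  -- 𝓛(X): all reduced words representing elements of X.
  ReducedWords : Pred Carrier ℓ → Pred (List (Fin n)) ℓ
  ReducedWords X u = Reduced u × X (value u)

fieldRing : ∀ {k ℓ₁ ℓ₂} → HeytingField k ℓ₁ ℓ₂ → Ring k ℓ₁
fieldRing K = CommutativeRing.ring
  (HeytingCommutativeRing.commutativeRing (HeytingField.heytingCommutativeRing K))

module _ {k ℓ₁ ℓ₂} (K : HeytingField k ℓ₁ ℓ₂) where
  open HeytingField K using (_#_)
  open Ring (fieldRing K)
  open RawMonoidDefs +-rawMonoid using () renaming (_×_ to _·_)

  -- In particular 1# # 0#, which HeytingField does not impose.
  CharacteristicZero : Set ℓ₂
  CharacteristicZero = ∀ n → (suc n · 1#) # 0#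

  IsInteger : Pred Carrier ℓ₁
  IsInteger x = ∃ λ n → x ≈ n · 1# ⊎ x ≈ - (n · 1#)

module _ {k ℓ₁ ℓ₂ m ℓm} (K : HeytingField k ℓ₁ ℓ₂)
         (V : LeftModule (fieldRing K) m ℓm) where
  open Ring (fieldRing K)
  open LeftModule V
  open RawMonoidDefs +ᴹ-rawMonoid using (sum) renaming (_×_ to _×ᴹ_)
  private
    module Scalars = LeftModule (TensorUnit.leftModule {R = fieldRing K})
  open LeftModuleMorphisms rawLeftModule Scalars.rawLeftModule
    using (IsLeftModuleHomomorphism)

  -- A (reduced, crystallographic) root system in V, with the finitely
  -- many roots listed without repetition.  Using coroots α^∨ ∈ V* rather
  -- than an inner product, s_α(v) = v - ⟨α^∨, v⟩ α; for a Euclidean root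
  -- system ⟨α^∨, v⟩ = 2(v, α)/(α, α).  Finite-dimensionality of V follows
  -- from `spanning`, and 0 ∉ Φ from `coroot-root` in characteristic zero.
  record RootSystem : Set (k ⊔ ℓ₁ ⊔ m ⊔ ℓm) where
    field
      size        : ℕ
      root        : Fin size → Carrierᴹ
      coroot      : Fin size → Carrierᴹ → Carrier

      distinct    : Injective _≡_ _≈ᴹ_ root
      spanning    : ∀ v → ∃ λ (c : Fin size → Carrier) →
                      v ≈ᴹ sum (λ i → c i *ₗ root i)
      linear      : ∀ i → IsLeftModuleHomomorphism (coroot i)
      coroot-root : ∀ i → coroot i (root i) ≈ 1# + 1#

    reflect : Fin size → Carrierᴹ → Carrierᴹ
    reflect i v = v +ᴹ -ᴹ (coroot i v *ₗ root i)

    field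
      stable      : ∀ i j → ∃ λ l → reflect i (root j) ≈ᴹ root l
      integral    : ∀ i j → IsInteger K (coroot i (root j))
      reduced     : ∀ i j c → root i ≈ᴹ c *ₗ root j → c ≈ 1# ⊎ c ≈ - 1#

    -- reflectAll (i₁ ∷ … ∷ iₜ ∷ []) is the map s_{i₁} ∘ … ∘ s_{iₜ}.
    reflectAll : List (Fin size) → Carrierᴹ → Carrierᴹ
    reflectAll []       = id
    reflectAll (i ∷ is) = reflect i ∘ reflectAll is

    reflect-cong : ∀ i {u v} → u ≈ᴹ v → reflect i u ≈ᴹ reflect i v
    reflect-cong i p = +ᴹ-cong p (-ᴹ‿cong (*ₗ-cong
      (IsLeftModuleHomomorphism.⟦⟧-cong (linear i) p) ≈ᴹ-refl))

    reflectAll-cong : ∀ is {u v} → u ≈ᴹ v → reflectAll is u ≈ᴹ reflectAll is v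
    reflectAll-cong []       p = p
    reflectAll-cong (i ∷ is) p = reflect-cong i (reflectAll-cong is p)

    coroot-reflect : ∀ i v → coroot i (reflect i v) ≈ - coroot i v
    coroot-reflect i v = begin
      coroot i (v +ᴹ -ᴹ (a *ₗ α))       ≈⟨ +ᴹ-homo v _ ⟩
      a + coroot i (-ᴹ (a *ₗ α))        ≈⟨ +-congˡ (-ᴹ-homo _) ⟩
      a + - coroot i (a *ₗ α)           ≈⟨ +-congˡ (-‿cong (*ₗ-homo a α)) ⟩
      a + - (a * coroot i α)            ≈⟨ +-congˡ (-‿cong (*-congˡ (coroot-root i))) ⟩
      a + - (a * (1# + 1#))             ≈⟨ +-congˡ (-‿cong (distribˡ a 1# 1#)) ⟩
      a + - (a * 1# + a * 1#)           ≈⟨ +-congˡ (-‿cong (+-cong (*-identityʳ a) (*-identityʳ a))) ⟩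
      a + - (a + a)                     ≈⟨ +-congˡ (RingProps.-‿+-comm (fieldRing K) a a) ⟨
      a + (- a + - a)                   ≈⟨ +-assoc a (- a) (- a) ⟨
      (a + - a) + - a                   ≈⟨ +-congʳ (-‿inverseʳ a) ⟩
      0# + - a                          ≈⟨ +-identityˡ (- a) ⟩
      - a                               ∎
      where
      open SetoidReasoning setoid
      open IsLeftModuleHomomorphism (linear i)
      a = coroot i v
      α = root i

    reflect-involutive : ∀ i v → reflect i (reflect i v) ≈ᴹ v
    reflect-involutive i v = begin
      w +ᴹ -ᴹ (coroot i w *ₗ α)                  ≈⟨ +ᴹ-congˡ (-ᴹ‿cong (*ₗ-congʳ (coroot-reflect i v))) ⟩
      (v +ᴹ -ᴹ (a *ₗ α)) +ᴹ -ᴹ ((- a) *ₗ α)      ≈⟨ +ᴹ-assoc v _ _ ⟩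
      v +ᴹ (-ᴹ (a *ₗ α) +ᴹ -ᴹ ((- a) *ₗ α))      ≈⟨ +ᴹ-congˡ (AbelianGroupProps.⁻¹-∙-comm +ᴹ-abelianGroup _ _) ⟩
      v +ᴹ -ᴹ (a *ₗ α +ᴹ (- a) *ₗ α)             ≈⟨ +ᴹ-congˡ (-ᴹ‿cong (*ₗ-distribʳ α a (- a))) ⟨
      v +ᴹ -ᴹ ((a + - a) *ₗ α)                   ≈⟨ +ᴹ-congˡ (-ᴹ‿cong (*ₗ-congʳ (-‿inverseʳ a))) ⟩
      v +ᴹ -ᴹ (0# *ₗ α)                          ≈⟨ +ᴹ-congˡ (-ᴹ‿cong (*ₗ-zeroˡ α)) ⟩
      v +ᴹ -ᴹ 0ᴹ                                 ≈⟨ +ᴹ-congˡ (AbelianGroupProps.ε⁻¹≈ε +ᴹ-abelianGroup) ⟩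
      v +ᴹ 0ᴹ                                    ≈⟨ +ᴹ-identityʳ v ⟩
      v                                          ∎
      where
      open SetoidReasoning ≈ᴹ-setoid
      w = reflect i v
      a = coroot i v
      α = root i

    reflectAll-++ : ∀ is js v → reflectAll (is ++ js) v ≡ reflectAll is (reflectAll js v)
    reflectAll-++ []       js v = ≡.refl
    reflectAll-++ (i ∷ is) js v = ≡.cong (reflect i) (reflectAll-++ is js v)

    reflectAll-reverse : ∀ is v → reflectAll (reverse is) (reflectAll is v) ≈ᴹ v
    reflectAll-reverse []       v = ≈ᴹ-refl
    reflectAll-reverse (i ∷ is) v = begin
      reflectAll (reverse (i ∷ is)) w     ≡⟨ ≡.cong (λ js → reflectAll js w) (unfold-reverse i is) ⟩
      reflectAll (reverse is ∷ʳ i) w      ≡⟨ reflectAll-++ (reverse is) [ i ] w ⟩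
      reflectAll (reverse is) (reflect i w)
        ≈⟨ reflectAll-cong (reverse is) (reflect-involutive i _) ⟩
      reflectAll (reverse is) (reflectAll is v) ≈⟨ reflectAll-reverse is v ⟩
      v                                   ∎
      where
      open SetoidReasoning ≈ᴹ-setoid
      w = reflectAll (i ∷ is) v

    -- The subgroup of GL(V) generated by the reflections in all roots.
    -- Reflections are involutions, so its elements are exactly the finite
    -- products of reflections; they are compared as maps on V.  It is finite:
    -- by `spanning`, an element is determined by how it permutes the roots.
    record Element : Set (m ⊔ ℓm) where
      field
        act       : Carrierᴹ → Carrierᴹ
        generated : ∃ λ is → ∀ v → act v ≈ᴹ reflectAll is v

      act-cong : ∀ {u v} → u ≈ᴹ v → act u ≈ᴹ act v
      act-cong {u} {v} p with generated
      ... | is , eq =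
        ≈ᴹ-trans (eq u) (≈ᴹ-trans (reflectAll-cong is p) (≈ᴹ-sym (eq v)))

    open Element

    reflection : Fin size → Element
    reflection i = record { act = reflect i ; generated = [ i ] , λ _ → ≈ᴹ-refl }

    identity : Element
    identity = record { act = id ; generated = [] , λ _ → ≈ᴹ-refl }

    compose : Element → Element → Element
    compose g h with generated g | generated h
    ... | is , p | js , q = record
      { act       = act g ∘ act h
      ; generated = is ++ js , λ v →
          ≈ᴹ-trans (p (act h v)) (≈ᴹ-trans (reflectAll-cong is (q v))
            (≈ᴹ-reflexive (≡.sym (reflectAll-++ is js v))))
      }

    inverse : Element → Element
    inverse g with generated g
    ... | is , _ = record
      { act       = reflectAll (reverse is)
      ; generated = reverse is , λ _ → ≈ᴹ-refl
      }

    inverse-left : ∀ g v → act (inverse g) (act g v) ≈ᴹ v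
    inverse-left g v with generated g
    ... | is , p =
      ≈ᴹ-trans (reflectAll-cong (reverse is) (p v)) (reflectAll-reverse is v)

    inverse-right : ∀ g v → act g (act (inverse g) v) ≈ᴹ v
    inverse-right g v with generated g
    ... | is , p = ≈ᴹ-trans (p _) (≈ᴹ-trans
      (≈ᴹ-reflexive (≡.cong (λ js → reflectAll js (reflectAll (reverse is) v))
        (≡.sym (reverse-involutive is))))
      (reflectAll-reverse (reverse is) v))

    inverse-cong : ∀ g h → (∀ v → act g v ≈ᴹ act h v) →
                   ∀ v → act (inverse g) v ≈ᴹ act (inverse h) v
    inverse-cong g h p v = begin
      act (inverse g) v                               ≈⟨ act-cong (inverse g) (inverse-right h v) ⟨
      act (inverse g) (act h (act (inverse h) v))     ≈⟨ act-cong (inverse g) (p _) ⟨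
      act (inverse g) (act g (act (inverse h) v))     ≈⟨ inverse-left g _ ⟩
      act (inverse h) v                               ∎
      where open SetoidReasoning ≈ᴹ-setoid

    weylGroup : Group (m ⊔ ℓm) (m ⊔ ℓm)
    weylGroup = record
      { Carrier = Element
      ; _≈_     = λ g h → ∀ v → act g v ≈ᴹ act h v
      ; _∙_     = compose
      ; ε       = identity
      ; _⁻¹     = inverse
      ; isGroup = record
        { isMonoid = record
          { isSemigroup = record
            { isMagma = record
              { isEquivalence = record
                { refl  = λ _ → ≈ᴹ-refl
                ; sym   = λ p v → ≈ᴹ-sym (p v)
                ; trans = λ p q v → ≈ᴹ-trans (p v) (q v)
                }
              ; ∙-cong = λ {g} {g′} {h} {h′} p q v →
                  ≈ᴹ-trans (act-cong g (q v)) (p (act h′ v))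
              }
            ; assoc = λ _ _ _ _ → ≈ᴹ-refl
            }
          ; identity = (λ _ _ → ≈ᴹ-refl) , (λ _ _ → ≈ᴹ-refl)
          }
        ; inverse = inverse-left , inverse-right
        ; ⁻¹-cong = λ {g} {h} → inverse-cong g h
        }
      }

  record Base (Φ : RootSystem) : Set (k ⊔ ℓ₁ ⊔ ℓm) where
    open RootSystem Φ
    field
      rank        : ℕ
      simple      : Fin rank → Fin size
      independent : ∀ (c : Fin rank → Carrier) →
                    sum (λ j → c j *ₗ root (simple j)) ≈ᴹ 0ᴹ →
                    ∀ j → c j ≈ 0#
      pos-or-neg  : ∀ i → ∃ λ (c : Fin rank → ℕ) →
                    let β = sum (λ j → c j ×ᴹ root (simple j)) in
                    root i ≈ᴹ β ⊎ root i ≈ᴹ -ᴹ β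

    simpleReflection : Fin rank → Group.Carrier weylGroup
    simpleReflection j = reflection (simple j)

    open Words weylGroup simpleReflection public

{-# OPTIONS --safe #-}

-- The Weyl group acts faithfully on the finitely many roots, because they
-- span V and are pairwise distinct; hence equality of group elements is
-- decidable and there are finitely many of them, whatever the field K.  The
-- rest holds in any finite group with a list of generators: prefixes of
-- reduced words are reduced, and all right contexts treat two reduced words
-- of the same value alike, as do all right contexts two non-reduced words.
-- So 𝓛(W^J) is a union of classes of a right congruence of finite index.

module Submission where

open import Defs
open import Algebra.Apartness.Bundles using (HeytingField)
open import Algebra.Bundles using (CommutativeMonoid; Group; Ring)
open import Algebra.Module.Bundles using (LeftModule)
open import Algebra.Module.Morphism.Structures using (module LeftModuleMorphisms)
import Algebra.Definitions.RawMonoid as RawMonoidDefs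
import Algebra.Module.Construct.TensorUnit as TensorUnit
import Algebra.Properties.AbelianGroup as AbelianGroupProps
import Algebra.Properties.CommutativeSemigroup as CommutativeSemigroupProps
import Algebra.Properties.Monoid.Sum as MonoidSum
open import Data.Bool.Base using (true)
open import Data.Fin.Base using (Fin; zero; suc; toℕ; combine; funToFin; finToFun)
open import Data.Fin.Properties
  using (_≟_; any?; all?; pigeonhole; toℕ≤pred[n]; suc-injective; finToFun-funToFin)
open import Data.Fin.Subset using (Subset; _∈_)
open import Data.Fin.Subset.Properties using (_∈?_)
open import Data.List.Base
  using (List; []; _∷_; _++_; _∷ʳ_; foldl; length; take; drop)
open import Data.List.Properties
  using (++-assoc; ++-identityʳ; length-++; length-take; length-++-sucʳ; take++drop≡id)
open import Data.Nat.Base using (ℕ; zero; suc; _+_; _^_; _≤_; _<_; z<s; s<s; s≤s; s≤s⁻¹)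
open import Data.Nat.Induction using (<-wellFounded)
open import Data.Nat.Properties
  using (_≤?_; _<?_; ≤-trans; ≤-antisym; n<1+n; ≰⇒>; ≮⇒≥; <⇒≱;
         +-monoˡ-<; m≤n⇒m⊓n≡m; module ≤-Reasoning)
open import Data.Product.Base using (∃; ∃₂; _×_; _,_; proj₁; proj₂)
open import Data.Sum.Base using (inj₁; inj₂; [_,_]′)
open import Data.Vec.Base using (tabulate)
open import Data.Vec.Properties using (lookup∘tabulate; []=⇒lookup; lookup⇒[]=)
open import Function.Base using (_∘_)
open import Function.Bundles using (_⇔_; mk⇔; Equivalence)
open import Induction.WellFounded using (Acc; acc)
open import Level using (Level)
open import Relation.Binary.PropositionalEquality as ≡ using (_≡_; refl; cong; cong₂; subst₂)
open import Relation.Nullary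
  using (Dec; yes; no; does; ¬_; ¬?; contradiction; _×-dec_; _⊎-dec_; _→-dec_)
open import Relation.Nullary.Decidable using (map′; dec-true)
open import Relation.Unary using (Pred; Decidable)
import Relation.Binary.Reasoning.Setoid as SetoidReasoning

-- Decision procedures for finite subsets and bounded searches over words.

does-true⇒ : ∀ {a} {A : Set a} (a? : Dec A) → does a? ≡ true → A
does-true⇒ (yes a) _ = a

∈-tabulate-does⇔ : ∀ {n p} {P : Pred (Fin n) p} (P? : Decidable P) i →
                   i ∈ tabulate (does ∘ P?) ⇔ P i
∈-tabulate-does⇔ P? i = mk⇔
  (λ i∈ → does-true⇒ (P? i) (≡.trans (≡.sym (lookup∘tabulate _ i)) ([]=⇒lookup i∈)))
  (λ Pi → lookup⇒[]= i _ (≡.trans (lookup∘tabulate _ i) (dec-true (P? i) Pi)))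

-- Over a finite alphabet only finitely many words lie below a length bound. Such a word is empty or
-- starts with some letter `i`; in the second case the search goes on for the tail, with the
-- predicate `P? ∘ (i ∷_)` and a bound smaller by one.
shorterWord? : ∀ {σ p} {P : Pred (List (Fin σ)) p} → Decidable P →
               ∀ k → Dec (∃ λ u → length u < k × P u)
shorterWord? P? zero    = no λ ()
shorterWord? P? (suc k) = map′
  [ (λ p → [] , z<s , p) , (λ (i , u , u<k , p) → i ∷ u , s<s u<k , p) ]′
  (λ where
    ([] , _ , p)          → inj₁ p
    (i ∷ u , s≤s u<k , p) → inj₂ (i , u , u<k , p))
  (P? [] ⊎-dec any? (λ i → shorterWord? (P? ∘ (i ∷_)) k))

-- Myhill-Nerode: a right congruence of finite index yields an automaton.

module FiniteIndex {σ N ℓ} {L : Pred (List (Fin σ)) ℓ}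
  (class : List (Fin σ) → Fin N)
  (class-∷ʳ : ∀ {u v} i → class u ≡ class v → class (u ∷ʳ i) ≡ class (v ∷ʳ i))
  (L? : Decidable L)
  (L-resp : ∀ {u v} → class u ≡ class v → L u → L v)
  where

  class-++ : ∀ {u v} w → class u ≡ class v → class (u ++ w) ≡ class (v ++ w)
  class-++ {u} {v} [] eq
    rewrite ++-identityʳ u | ++-identityʳ v = eq
  class-++ {u} {v} (i ∷ w) eq
    rewrite ≡.sym (++-assoc u (i ∷ []) w) | ≡.sym (++-assoc v (i ∷ []) w) =
    class-++ w (class-∷ʳ i eq)

  -- Pumping argument: of the `N + 1` prefixes of lengths `0` to `N`, two share a class, and the
  -- letters between them can be cut out.
  shorten : ∀ u → N ≤ length u → ∃ λ v → length v < length u × class v ≡ class u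
  shorten u N≤u
    with i , j , i<j , eq ← pigeonhole (n<1+n N) (λ j → class (take (toℕ j) u)) =
      -- The shorter prefix replaces the longer one in front of the same rest; `class-++` carries
      -- the equality of classes past that rest.
      take (toℕ i) u ++ drop (toℕ j) u , shorter
    , ≡.trans (class-++ (drop (toℕ j) u) eq) (cong class (take++drop≡id (toℕ j) u))
    where
    length-take-≤ : ∀ (k : Fin (suc N)) → length (take (toℕ k) u) ≡ toℕ k
    length-take-≤ k = ≡.trans (length-take (toℕ k) u)
      (m≤n⇒m⊓n≡m (≤-trans (toℕ≤pred[n] k) N≤u))

    shorter : length (take (toℕ i) u ++ drop (toℕ j) u) < length u
    shorter = begin-strict
      length (take (toℕ i) u ++ drop (toℕ j) u)           ≡⟨ length-++ (take (toℕ i) u) ⟩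
      length (take (toℕ i) u) + length (drop (toℕ j) u)
        <⟨ +-monoˡ-< (length (drop (toℕ j) u))
             (subst₂ _<_ (≡.sym (length-take-≤ i)) (≡.sym (length-take-≤ j)) i<j) ⟩
      length (take (toℕ j) u) + length (drop (toℕ j) u)   ≡⟨ length-++ (take (toℕ j) u) ⟨
      length (take (toℕ j) u ++ drop (toℕ j) u)           ≡⟨ cong length (take++drop≡id (toℕ j) u) ⟩
      length u                                            ∎
      where open ≤-Reasoning

  shortRepresentative : ∀ u → Acc _<_ (length u) →
                        ∃ λ v → length v < N × class v ≡ class u
  shortRepresentative u (acc rs) with N ≤? length u
  ... | no  N≰u = u , ≰⇒> N≰u , refl
  ... | yes N≤u with v , v<u , v≡u ← shorten u N≤u
                with w , w<N , w≡v ← shortRepresentative v (rs v<u) =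
    w , w<N , ≡.trans w≡v v≡u

  -- Every attained class contains a word shorter than `N`, so a bounded search decides an unbounded
  -- existence statement.
  class-image? : ∀ q → Dec (∃ λ u → class u ≡ q)
  class-image? q = map′
    (λ (u , _ , eq) → u , eq)
    (λ where (u , refl) → shortRepresentative u (<-wellFounded _))
    (shorterWord? (λ u → class u ≟ q) N)

  -- Junk value [] outside the image of class; such states are unreachable.
  representative : Fin N → List (Fin σ)
  representative q with class-image? q
  ... | yes (u , _) = u
  ... | no  _       = []

  class-representative : ∀ u → class (representative (class u)) ≡ class u
  class-representative u with class-image? (class u)
  ... | yes (_ , eq) = eq
  ... | no  ∄        = contradiction (u , refl) ∄

  -- The quotient automaton of the congruence. A state is only a number, so transitions and
  -- acceptance are read off a representative word.
  dfa : DFA σ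
  dfa = record
    { states    = N
    ; start     = class []
    ; step      = λ q i → class (representative q ∷ʳ i)
    ; accepting = tabulate (does ∘ L? ∘ representative)
    }

  open DFA dfa using (step; Accepts)

  -- Induction on `w` moves letters into `u`, hence the arbitrary starting word. `step` extends the
  -- representative instead of `u`; by `class-∷ʳ` both extensions have the same class.
  foldl-step : ∀ u w → foldl step (class u) w ≡ class (u ++ w)
  foldl-step u []      = cong class (≡.sym (++-identityʳ u))
  foldl-step u (i ∷ w) = begin
    foldl step (class (representative (class u) ∷ʳ i)) w
      ≡⟨ cong (λ q → foldl step q w) (class-∷ʳ i (class-representative u)) ⟩
    foldl step (class (u ∷ʳ i)) w   ≡⟨ foldl-step (u ∷ʳ i) w ⟩
    class ((u ∷ʳ i) ++ w)           ≡⟨ cong class (++-assoc u (i ∷ []) w) ⟩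
    class (u ++ i ∷ w)              ∎
    where open ≡.≡-Reasoning

  regular : Regular L
  regular = dfa , λ w → mk⇔ (to w) (from w)
    where
    to : ∀ w → L w → Accepts w
    to w Lw rewrite foldl-step [] w =
      Equivalence.from (∈-tabulate-does⇔ (L? ∘ representative) (class w))
        (L-resp (≡.sym (class-representative w)) Lw)

    from : ∀ w → Accepts w → L w
    from w acc-w rewrite foldl-step [] w =
      L-resp (class-representative w)
        (Equivalence.to (∈-tabulate-does⇔ (L? ∘ representative) (class w)) acc-w)

-- Reduced words and minimal representatives in a finite group.

module FiniteGroup {c ℓ} (W : Group c ℓ) {n N : ℕ} (s : Fin n → Group.Carrier W)
  (code : Group.Carrier W → Fin N)
  (code-cong : ∀ {g h} → Group._≈_ W g h → code g ≡ code h)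
  (code-injective : ∀ {g h} → code g ≡ code h → Group._≈_ W g h)
  where

  open Group W renaming (refl to ≈-refl; sym to ≈-sym; trans to ≈-trans)
  open Words W s

  _≈?_ : ∀ g h → Dec (g ≈ h)
  g ≈? h = map′ code-injective code-cong (code g ≟ code h)

  value-∷ʳ : ∀ u i → value (u ∷ʳ i) ≈ s i ∙ value u
  value-∷ʳ []      i = ≈-trans (identityˡ _) (≈-sym (identityʳ _))
  value-∷ʳ (j ∷ u) i = ≈-trans (∙-congʳ (value-∷ʳ u i)) (assoc _ _ _)

  value-∷ʳ-cong : ∀ u v i → value u ≈ value v → value (u ∷ʳ i) ≈ value (v ∷ʳ i)
  value-∷ʳ-cong u v i eq =
    ≈-trans (value-∷ʳ u i) (≈-trans (∙-congˡ eq) (≈-sym (value-∷ʳ v i)))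

  HasLength-resp : ∀ {g h k} → g ≈ h → HasLength g k → HasLength h k
  HasLength-resp g≈h ((u , u≈g , u≡k) , minimal) =
    (u , ≈-trans u≈g g≈h , u≡k) , λ v v≈h → minimal v (≈-trans v≈h (≈-sym g≈h))

  HasLength-unique : ∀ {g k l} → HasLength g k → HasLength g l → k ≡ l
  HasLength-unique ((u , u≈g , refl) , minᵤ) ((v , v≈g , refl) , minᵥ) =
    ≤-antisym (minᵤ v v≈g) (minᵥ u u≈g)

  -- The minimality half of `Reduced`; for the other half, `u` itself is the witness.
  Shortest : Pred (List (Fin n)) ℓ
  Shortest u = ∀ v → value v ≈ value u → length u ≤ length v

  shortest⇒reduced : ∀ u → Shortest u → Reduced u
  shortest⇒reduced u minimal = (u , ≈-refl , refl) , minimal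

  ShorterEqual : List (Fin n) → Pred (List (Fin n)) ℓ
  ShorterEqual u v = length v < length u × value v ≈ value u

  shorterEqual? : ∀ u → Dec (∃ (ShorterEqual u))
  shorterEqual? u = shorterWord? (λ v → value v ≈? value u) (length u)

  ∄-shorter⇒reduced : ∀ u → ¬ ∃ (ShorterEqual u) → Reduced u
  ∄-shorter⇒reduced u ∄ =
    shortest⇒reduced u λ v v≈u → ≮⇒≥ λ v<u → ∄ (v , v<u , v≈u)

  reduced? : Decidable Reduced
  reduced? u = map′ (∄-shorter⇒reduced u)
    (λ (_ , minimal) (v , v<u , v≈u) → <⇒≱ v<u (minimal v v≈u))
    (¬? (shorterEqual? u))

  -- If a shorter word had the value of `u`, appending `i` to it would give a shorter word with the
  -- value of `u ∷ʳ i`.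
  reduced-prefix : ∀ u i → Reduced (u ∷ʳ i) → Reduced u
  reduced-prefix u i (_ , minimal) = shortest⇒reduced u λ v v≈u → s≤s⁻¹
    (subst₂ _≤_ (length-∷ʳ u) (length-∷ʳ v) (minimal (v ∷ʳ i) (value-∷ʳ-cong v u i v≈u)))
    where
    length-∷ʳ : ∀ w → length (w ∷ʳ i) ≡ suc (length w)
    length-∷ʳ w = ≡.trans (length-++-sucʳ w i []) (cong (suc ∘ length) (++-identityʳ w))

  reduced-same-length : ∀ u v → Reduced u → Reduced v → value u ≈ value v →
                        length u ≡ length v
  reduced-same-length u v ru rv eq = HasLength-unique (HasLength-resp eq ru) rv

  -- Reduced words of equal value have equal length, so the two extensions agree in both value and
  -- length, and minimality transfers.
  reduced-∷ʳ-resp : ∀ u v i → Reduced u → Reduced v → value u ≈ value v →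
                    Reduced (u ∷ʳ i) → Reduced (v ∷ʳ i)
  reduced-∷ʳ-resp u v i ru rv eq (_ , minimal) = shortest⇒reduced (v ∷ʳ i) λ w w≈vi →
    ≡.subst (_≤ length w) same-length
      (minimal w (≈-trans w≈vi (≈-sym (value-∷ʳ-cong u v i eq))))
    where
    same-length : length (u ∷ʳ i) ≡ length (v ∷ʳ i)
    same-length = ≡.trans (length-++ u)
      (≡.trans (cong (_+ 1) (reduced-same-length u v ru rv eq)) (≡.sym (length-++ v)))

  -- Passing to a shorter word of the same value must stop, and it stops at a reduced word.
  lengthOf : ∀ u → Acc _<_ (length u) → ∃ (HasLength (value u))
  lengthOf u (acc rs) with shorterEqual? u
  ... | no ∄                = length u , ∄-shorter⇒reduced u ∄
  ... | yes (v , v<u , v≈u) with k , v-k ← lengthOf v (rs v<u) =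
    k , HasLength-resp v≈u v-k

  -- `MinimalRep` quantifies over all pairs of lengths, but lengths exist and are unique, so
  -- comparing the computed ones suffices.
  minimalRep? : ∀ J u → Dec (MinimalRep J (value u))
  minimalRep? J u = all? λ j → j ∈? J →-dec ascent? j
    where
    ascent? : ∀ j → Dec (∃₂ λ k l →
      HasLength (value u) k × HasLength (value u ∙ s j) l × k < l)
    ascent? j
      with k , u-k  ← lengthOf u (<-wellFounded _)
      -- `value (j ∷ u)` is by definition `value u ∙ s j`: a letter put in front multiplies on the
      -- right.
      with l , uj-l ← lengthOf (j ∷ u) (<-wellFounded _) = map′
        (λ k<l → k , l , u-k , uj-l , k<l)
        (λ (_ , _ , u-k′ , uj-l′ , k′<l′) →
          subst₂ _<_ (HasLength-unique u-k′ u-k) (HasLength-unique uj-l′ uj-l) k′<l′)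
        (k <? l)

  minimalRep-resp : ∀ J {g h} → g ≈ h → MinimalRep J g → MinimalRep J h
  minimalRep-resp J g≈h min j j∈J with k , l , g-k , gj-l , k<l ← min j j∈J =
    k , l , HasLength-resp g≈h g-k , HasLength-resp (∙-congʳ g≈h) gj-l , k<l

  -- All non-reduced words share the class `zero`; the codes of reduced words are shifted by one to
  -- keep it free.
  class : List (Fin n) → Fin (suc N)
  class u with reduced? u
  ... | yes _ = suc (code (value u))
  ... | no  _ = zero

  -- The kernel of `class`, stated without codes so that proofs can split on its two cases.
  data _∼_ (u v : List (Fin n)) : Set ℓ where
    both-reduced : Reduced u → Reduced v → value u ≈ value v → u ∼ v
    none-reduced : ¬ Reduced u → ¬ Reduced v → u ∼ v

  class-sound : ∀ {u v} → class u ≡ class v → u ∼ v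
  class-sound {u} {v} eq with reduced? u | reduced? v
  class-sound eq | yes ru | yes rv = both-reduced ru rv (code-injective (suc-injective eq))
  class-sound () | yes _  | no _
  class-sound () | no _   | yes _
  class-sound _  | no ¬ru | no ¬rv = none-reduced ¬ru ¬rv

  class-complete : ∀ {u v} → u ∼ v → class u ≡ class v
  class-complete {u} {v} u∼v with reduced? u | reduced? v | u∼v
  ... | yes _  | yes _  | both-reduced _ _ eq  = cong suc (code-cong eq)
  ... | no _   | no _   | _                    = refl
  ... | yes _  | no ¬rv | both-reduced _ rv _  = contradiction rv ¬rv
  ... | no ¬ru | yes _  | both-reduced ru _ _  = contradiction ru ¬ru
  ... | yes ru | _      | none-reduced ¬ru _   = contradiction ru ¬ru
  ... | no _   | yes rv | none-reduced _ ¬rv   = contradiction rv ¬rv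

  -- An extension of a non-reduced word is never reduced, so `zero` is a sink. Reduced words of
  -- equal value leave reducedness together, by `reduced-∷ʳ-resp` in both directions.
  ∼-∷ʳ : ∀ {u v} i → u ∼ v → (u ∷ʳ i) ∼ (v ∷ʳ i)
  ∼-∷ʳ {u} {v} i (none-reduced ¬ru ¬rv) =
    none-reduced (¬ru ∘ reduced-prefix u i) (¬rv ∘ reduced-prefix v i)
  ∼-∷ʳ {u} {v} i (both-reduced ru rv eq) with reduced? (u ∷ʳ i)
  ... | yes rui = both-reduced rui (reduced-∷ʳ-resp u v i ru rv eq rui) (value-∷ʳ-cong u v i eq)
  ... | no ¬rui = none-reduced ¬rui (¬rui ∘ reduced-∷ʳ-resp v u i rv ru (≈-sym eq))

  reducedWords-resp : ∀ J {u v} → u ∼ v →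
    ReducedWords (MinimalRep J) u → ReducedWords (MinimalRep J) v
  reducedWords-resp J (both-reduced _ rv eq) (_ , min) = rv , minimalRep-resp J eq min
  reducedWords-resp J (none-reduced ¬ru _)   (ru , _)  = contradiction ru ¬ru

  regular : ∀ J → Regular (ReducedWords (MinimalRep J))
  regular J = FiniteIndex.regular class
    (λ {u} {v} i → class-complete ∘ ∼-∷ʳ i ∘ class-sound {u} {v})
    (λ u → reduced? u ×-dec minimalRep? J u)
    (λ {u} {v} → reducedWords-resp J ∘ class-sound {u} {v})

-- Weyl group elements encoded by their action on the roots.

funToFin-cong : ∀ {m n} {f g : Fin m → Fin n} → (∀ i → f i ≡ g i) →
                funToFin f ≡ funToFin g
funToFin-cong {zero}  f≗g = refl
funToFin-cong {suc m} f≗g = cong₂ combine (f≗g zero) (funToFin-cong (f≗g ∘ suc))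

module RootPermutations {k ℓ₁ ℓ₂ m ℓm} (K : HeytingField k ℓ₁ ℓ₂)
  (V : LeftModule (fieldRing K) m ℓm) (Φ : RootSystem K V) where

  open Ring (fieldRing K) using (_*_) renaming (Carrier to Scalar)
  open LeftModule V
  open RawMonoidDefs +ᴹ-rawMonoid using (sum)
  open MonoidSum +ᴹ-monoid using (sum-cong-≋)
  open RootSystem Φ
  open Element
  private
    module Scalars = LeftModule (TensorUnit.leftModule {R = fieldRing K})
    module Coroot (i : Fin size) = LeftModuleMorphisms.IsLeftModuleHomomorphism
      {M₁ = rawLeftModule} {M₂ = Scalars.rawLeftModule} (linear i)
  open SetoidReasoning ≈ᴹ-setoid

  reflect-+ᴹ : ∀ i u v → reflect i (u +ᴹ v) ≈ᴹ reflect i u +ᴹ reflect i v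
  reflect-+ᴹ i u v = begin
    (u +ᴹ v) +ᴹ -ᴹ (coroot i (u +ᴹ v) *ₗ α)
      ≈⟨ +ᴹ-congˡ (-ᴹ‿cong (*ₗ-congʳ (Coroot.+ᴹ-homo i u v))) ⟩
    (u +ᴹ v) +ᴹ -ᴹ ((coroot i u Scalars.+ᴹ coroot i v) *ₗ α)
      ≈⟨ +ᴹ-congˡ (-ᴹ‿cong (*ₗ-distribʳ α _ _)) ⟩
    (u +ᴹ v) +ᴹ -ᴹ (coroot i u *ₗ α +ᴹ coroot i v *ₗ α)
      ≈⟨ +ᴹ-congˡ (AbelianGroupProps.⁻¹-∙-comm +ᴹ-abelianGroup _ _) ⟨
    (u +ᴹ v) +ᴹ (-ᴹ (coroot i u *ₗ α) +ᴹ -ᴹ (coroot i v *ₗ α))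
      ≈⟨ CommutativeSemigroupProps.interchange
           (CommutativeMonoid.commutativeSemigroup +ᴹ-commutativeMonoid) u v _ _ ⟩
    reflect i u +ᴹ reflect i v ∎
    where α = root i

  reflect-*ₗ : ∀ i c v → reflect i (c *ₗ v) ≈ᴹ c *ₗ reflect i v
  reflect-*ₗ i c v = begin
    c *ₗ v +ᴹ -ᴹ (coroot i (c *ₗ v) *ₗ α)
      ≈⟨ +ᴹ-congˡ (-ᴹ‿cong (*ₗ-congʳ (Coroot.*ₗ-homo i c v))) ⟩
    c *ₗ v +ᴹ -ᴹ ((c * coroot i v) *ₗ α)
      ≈⟨ +ᴹ-congˡ (-ᴹ‿cong (*ₗ-assoc c _ α)) ⟩
    c *ₗ v +ᴹ -ᴹ (c *ₗ x)
      -- `c *ₗ -ᴹ x` is the negative of `c *ₗ x` by uniqueness of inverses.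
      ≈⟨ +ᴹ-congˡ (AbelianGroupProps.inverseʳ-unique +ᴹ-abelianGroup _ _ cx-cx) ⟨
    c *ₗ v +ᴹ c *ₗ -ᴹ x
      ≈⟨ *ₗ-distribˡ c v (-ᴹ x) ⟨
    c *ₗ reflect i v ∎
    where
    α = root i
    x = coroot i v *ₗ α
    cx-cx : c *ₗ x +ᴹ c *ₗ -ᴹ x ≈ᴹ 0ᴹ
    cx-cx = begin
      c *ₗ x +ᴹ c *ₗ -ᴹ x    ≈⟨ *ₗ-distribˡ c x (-ᴹ x) ⟨
      c *ₗ (x +ᴹ -ᴹ x)       ≈⟨ *ₗ-congˡ (-ᴹ‿inverseʳ x) ⟩
      c *ₗ 0ᴹ                ≈⟨ *ₗ-zeroʳ c ⟩
      0ᴹ                     ∎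

  reflect-0ᴹ : ∀ i → reflect i 0ᴹ ≈ᴹ 0ᴹ
  reflect-0ᴹ i = begin
    reflect i 0ᴹ            ≈⟨ reflect-cong i (*ₗ-zeroˡ 0ᴹ) ⟨
    reflect i (Scalars.0ᴹ *ₗ 0ᴹ)    ≈⟨ reflect-*ₗ i Scalars.0ᴹ 0ᴹ ⟩
    Scalars.0ᴹ *ₗ reflect i 0ᴹ      ≈⟨ *ₗ-zeroˡ _ ⟩
    0ᴹ                      ∎

  reflect-sum : ∀ i {n} (c : Fin n → Scalar) (x : Fin n → Carrierᴹ) →
    reflect i (sum (λ j → c j *ₗ x j)) ≈ᴹ sum (λ j → c j *ₗ reflect i (x j))
  reflect-sum i {zero}  c x = reflect-0ᴹ i
  reflect-sum i {suc n} c x = ≈ᴹ-trans (reflect-+ᴹ i _ _)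
    (+ᴹ-cong (reflect-*ₗ i (c zero) (x zero)) (reflect-sum i (c ∘ suc) (x ∘ suc)))

  reflectAll-sum : ∀ is {n} (c : Fin n → Scalar) (x : Fin n → Carrierᴹ) →
    reflectAll is (sum (λ j → c j *ₗ x j)) ≈ᴹ sum (λ j → c j *ₗ reflectAll is (x j))
  reflectAll-sum []       c x = ≈ᴹ-refl
  reflectAll-sum (i ∷ is) c x =
    ≈ᴹ-trans (reflect-cong i (reflectAll-sum is c x)) (reflect-sum i c (reflectAll is ∘ x))

  -- `act g` is given as a bare function; its linearity comes from the product of reflections
  -- supplied by `generated`.
  act-sum : ∀ g {n} (c : Fin n → Scalar) (x : Fin n → Carrierᴹ) →
    act g (sum (λ j → c j *ₗ x j)) ≈ᴹ sum (λ j → c j *ₗ act g (x j))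
  act-sum g c x with is , eq ← generated g = ≈ᴹ-trans (eq _)
    (≈ᴹ-trans (reflectAll-sum is c x)
      (sum-cong-≋ λ j → *ₗ-congˡ (≈ᴹ-sym (eq (x j)))))

  -- The roots span `V` and both actions are linear.
  act-determined-by-roots : ∀ g h → (∀ j → act g (root j) ≈ᴹ act h (root j)) →
                            ∀ v → act g v ≈ᴹ act h v
  act-determined-by-roots g h eq v with c , v≈ ← spanning v = begin
    act g v                                  ≈⟨ act-cong g v≈ ⟩
    act g (sum (λ j → c j *ₗ root j))        ≈⟨ act-sum g c root ⟩
    sum (λ j → c j *ₗ act g (root j))        ≈⟨ sum-cong-≋ (λ j → *ₗ-congˡ (eq j)) ⟩
    sum (λ j → c j *ₗ act h (root j))        ≈⟨ act-sum h c root ⟨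
    act h (sum (λ j → c j *ₗ root j))        ≈⟨ act-cong h v≈ ⟨
    act h v                                  ∎

  reflectAll-root : ∀ is j → ∃ λ l → reflectAll is (root j) ≈ᴹ root l
  reflectAll-root []       j = j , ≈ᴹ-refl
  reflectAll-root (i ∷ is) j
    with l , eq  ← reflectAll-root is j
    with l′ , eq′ ← stable i l = l′ , ≈ᴹ-trans (reflect-cong i eq) eq′

  act-root : ∀ g j → ∃ λ l → act g (root j) ≈ᴹ root l
  act-root g j with is , eq ← generated g
               with l , eq′ ← reflectAll-root is j = l , ≈ᴹ-trans (eq _) eq′

  permutation : Element → Fin size → Fin size
  permutation g j = proj₁ (act-root g j)

  -- Equal elements may come with different products of reflections, but by `distinct` a root has
  -- only one index.
  permutation-cong : ∀ g h → (∀ v → act g v ≈ᴹ act h v) →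
                     ∀ j → permutation g j ≡ permutation h j
  permutation-cong g h g≈h j = distinct
    (≈ᴹ-trans (≈ᴹ-sym (proj₂ (act-root g j)))
      (≈ᴹ-trans (g≈h (root j)) (proj₂ (act-root h j))))

  permutation-injective : ∀ g h → (∀ j → permutation g j ≡ permutation h j) →
                          ∀ v → act g v ≈ᴹ act h v
  permutation-injective g h eq = act-determined-by-roots g h λ j →
    ≈ᴹ-trans (proj₂ (act-root g j))
      (≈ᴹ-trans (≈ᴹ-reflexive (cong root (eq j))) (≈ᴹ-sym (proj₂ (act-root h j))))

  -- The bound counts all self-maps of the set of root indices, among which the actions of group
  -- elements lie.
  code : Element → Fin (size ^ size)
  code = funToFin ∘ permutation

  code-cong : ∀ {g h} → (∀ v → act g v ≈ᴹ act h v) → code g ≡ code h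
  code-cong {g} {h} g≈h = funToFin-cong (permutation-cong g h g≈h)

  code-injective : ∀ {g h} → code g ≡ code h → ∀ v → act g v ≈ᴹ act h v
  code-injective {g} {h} eq = permutation-injective g h λ j →
    subst₂ _≡_ (finToFun-funToFin (permutation g) j) (finToFun-funToFin (permutation h) j)
      (cong (λ q → finToFun q j) eq)

theorem3p12 : ∀ {k ℓ₁ ℓ₂ m ℓm : Level}
    (K : HeytingField k ℓ₁ ℓ₂) → CharacteristicZero K →
    (V : LeftModule (fieldRing K) m ℓm)
    (Φ : RootSystem K V) (Δ : Base K V Φ)
    (J : Subset (Base.rank Δ)) →
    Regular (Base.ReducedWords Δ (Base.MinimalRep Δ J))
theorem3p12 K _ V Φ Δ = FiniteGroup.regular
  (RootSystem.weylGroup Φ) (Base.simpleReflection Δ)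
  code (λ {g} {h} → code-cong {g} {h}) (λ {g} {h} → code-injective {g} {h})
  where open RootPermutations K V Φ
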